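{- Let $n>4$ be a natural number. Every finite $\mathrm G_{n\sim}$-algebra is a finite direct product of finite $\mathrm G_{n\sim}$-chains.
   Context: $\mathbf{GV}_{n\sim}$ is the algebra on $\{0,\frac1{n-1},\dots,\frac{n-2}{n-1},1\}$ with $\wedge=\min$, $x\to y=1$ if $x\le y$ and $x\to y=y$ otherwise, $\sim x=1-x$, and constant $\bot=0$. $\mathrm G_{n\sim}$-algebras are the members of the variety generated by $\mathbf{GV}_{n\sim}$, and $\mathrm G_{n\sim}$-chains are the linearly ordered $\mathrm G_{n\sim}$-algebras (with respect to the lattice order given by $\wedge$). "Is a direct product" is up to isomorphism. -}

module Defs where

open import Data.Fin.Base using (Fin; toℕ; opposite)
import Data.Fin.Base as Fin
open import Data.Fin.Properties using (toℕ≤pred[n]; opposite-prop)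
open import Data.Integer.Base as ℤ using (+_)
import Data.Integer.Properties as ℤ
open import Data.Nat.Base as ℕ using (ℕ; suc; pred; 2+; NonZero; NonTrivial)
import Data.Nat.Properties as ℕ
open import Data.Product.Base using (∃; _×_; _,_; proj₁)
open import Data.Rational.Base using (ℚ; _/_; 0ℚ; 1ℚ; _⊓_; _+_; _-_; -_; toℚᵘ)
open import Data.Rational.Properties as ℚ using (_≤?_)
import Data.Rational.Unnormalised.Base as ℚᵘ
import Data.Rational.Unnormalised.Properties as ℚᵘ
open import Data.Sum.Base using (inj₁; inj₂)
open import Function.Base using (_on_)
open import Function.Bundles using (Inverse; Bijection)
open import Level using (Level; _⊔_; 0ℓ) renaming (suc to lsuc)
open import Relation.Binary.Bundles using (Setoid)
import Relation.Binary.Construct.NaturalOrder.Left as NaturalOrder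
import Relation.Binary.Construct.On as On
open import Relation.Binary.Core using (Rel)
open import Relation.Binary.Structures using (IsEquivalence; IsTotalOrder)
open import Relation.Binary.PropositionalEquality as ≡
  using (_≡_; refl; sym; trans; cong; cong₂; subst)
open import Relation.Nullary.Decidable using (yes; no)

private
  variable
    c ℓ c₁ ℓ₁ c₂ ℓ₂ : Level

record Algebra (c ℓ : Level) : Set (lsuc (c ⊔ ℓ)) where
  infix  4 _≈_
  infixr 7 _∧_
  infixr 6 _⇒_
  infix  8 ∼_
  field
    Carrier       : Set c
    _≈_           : Rel Carrier ℓ
    _∧_           : Carrier → Carrier → Carrier
    _⇒_           : Carrier → Carrier → Carrier
    ∼_            : Carrier → Carrier
    ⊥             : Carrier
    isEquivalence : IsEquivalence _≈_
    ∧-cong        : ∀ {x y u v} → x ≈ y → u ≈ v → x ∧ u ≈ y ∧ v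
    ⇒-cong        : ∀ {x y u v} → x ≈ y → u ≈ v → x ⇒ u ≈ y ⇒ v
    ∼-cong        : ∀ {x y} → x ≈ y → ∼ x ≈ ∼ y

  setoid : Setoid c ℓ
  setoid = record { isEquivalence = isEquivalence }

  open NaturalOrder _≈_ _∧_ public using (_≤_)

data Term : Set where
  var  : ℕ → Term
  _∧_  : Term → Term → Term
  _⇒_  : Term → Term → Term
  ∼_   : Term → Term
  ⊥    : Term

module _ (A : Algebra c ℓ) where
  private module A = Algebra A

  ⟦_⟧ : Term → (ℕ → A.Carrier) → A.Carrier
  ⟦ var i ⟧ ρ = ρ i
  ⟦ s ∧ t ⟧ ρ = ⟦ s ⟧ ρ A.∧ ⟦ t ⟧ ρ
  ⟦ s ⇒ t ⟧ ρ = ⟦ s ⟧ ρ A.⇒ ⟦ t ⟧ ρ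
  ⟦ ∼ t ⟧   ρ = A.∼ ⟦ t ⟧ ρ
  ⟦ ⊥ ⟧     ρ = A.⊥

infix 4 _⊨_

_⊨_ : Algebra c ℓ → Rel Term 0ℓ → Set (c ⊔ ℓ)
A ⊨ E = ∀ {s t} → E s t → ∀ ρ → ⟦ A ⟧ s ρ ≈ ⟦ A ⟧ t ρ
  where open Algebra A using (_≈_)

-- A variety is the class of models of a set E of identities; the variety
-- generated by K is the intersection of all varieties containing K.
_∈Variety_ : Algebra c₁ ℓ₁ → Algebra c₂ ℓ₂ → Set (lsuc 0ℓ ⊔ c₁ ⊔ ℓ₁ ⊔ c₂ ⊔ ℓ₂)
A ∈Variety K = ∀ (E : Rel Term 0ℓ) → K ⊨ E → A ⊨ E

Finite : Algebra c ℓ → Set (c ⊔ ℓ)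
Finite A = ∃ λ m → Inverse (Algebra.setoid A) (≡.setoid (Fin m))

module _ (A : Algebra c₁ ℓ₁) (B : Algebra c₂ ℓ₂) where
  private
    module A = Algebra A
    module B = Algebra B

  record IsHomomorphism (f : A.Carrier → B.Carrier) : Set (c₁ ⊔ ℓ₂) where
    field
      ∧-homo : ∀ x y → f (x A.∧ y) B.≈ f x B.∧ f y
      ⇒-homo : ∀ x y → f (x A.⇒ y) B.≈ f x B.⇒ f y
      ∼-homo : ∀ x → f (A.∼ x) B.≈ B.∼ f x
      ⊥-homo : f A.⊥ B.≈ B.⊥

  infix 4 _≅_

  record _≅_ : Set (c₁ ⊔ ℓ₁ ⊔ c₂ ⊔ ℓ₂) where
    field
      bijection      : Bijection A.setoid B.setoid
      isHomomorphism : IsHomomorphism (Bijection.to bijection)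

∏ : ∀ {k} → (Fin k → Algebra c ℓ) → Algebra c ℓ
∏ {k = k} B = record
  { Carrier       = ∀ i → B.Carrier i
  ; _≈_           = λ x y → ∀ i → B._≈_ i (x i) (y i)
  ; _∧_           = λ x y i → B._∧_ i (x i) (y i)
  ; _⇒_           = λ x y i → B._⇒_ i (x i) (y i)
  ; ∼_            = λ x i → B.∼_ i (x i)
  ; ⊥             = λ i → B.⊥ i
  ; isEquivalence = record
    { refl  = λ i → IsEquivalence.refl (B.isEquivalence i)
    ; sym   = λ p i → IsEquivalence.sym (B.isEquivalence i) (p i)
    ; trans = λ p q i → IsEquivalence.trans (B.isEquivalence i) (p i) (q i)
    }
  ; ∧-cong        = λ p q i → B.∧-cong i (p i) (q i)
  ; ⇒-cong        = λ p q i → B.⇒-cong i (p i) (q i)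
  ; ∼-cong        = λ p i → B.∼-cong i (p i)
  }
  where module B (i : Fin k) = Algebra (B i)

infixr 6 _⇒ᴳ_

_⇒ᴳ_ : ℚ → ℚ → ℚ
x ⇒ᴳ y with x ≤? y
... | yes _ = 1ℚ
... | no  _ = y

private
  pred-nonZero : ∀ n → .{{NonTrivial n}} → NonZero (pred n)
  pred-nonZero (2+ _) = _

  /-complement : ∀ i j d .{{_ : NonZero d}} → i ℕ.+ j ≡ d →
                 1ℚ - + i / d ≡ + j / d
  /-complement i j d@(suc k) i+j≡d = begin
    1ℚ - p         ≡⟨ cong (_- p) p+q≡1 ⟨
    (p + q) - p    ≡⟨ cong (_- p) (ℚ.+-comm p q) ⟩
    (q + p) - p    ≡⟨ ℚ.+-assoc q p (- p) ⟩
    q + (p - p)    ≡⟨ cong (λ r → q + r) (ℚ.+-inverseʳ p) ⟩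
    q + 0ℚ         ≡⟨ ℚ.+-identityʳ q ⟩
    q              ∎
    where
    open ≡.≡-Reasoning
    p = + i / d
    q = + j / d
    num : (+ i ℤ.* + d ℤ.+ + j ℤ.* + d) ℤ.* + 1 ≡ + 1 ℤ.* (+ d ℤ.* + d)
    num = begin
      (+ i ℤ.* + d ℤ.+ + j ℤ.* + d) ℤ.* + 1 ≡⟨ ℤ.*-identityʳ _ ⟩
      + i ℤ.* + d ℤ.+ + j ℤ.* + d           ≡⟨ ℤ.*-distribʳ-+ (+ d) (+ i) (+ j) ⟨
      + (i ℕ.+ j) ℤ.* + d                   ≡⟨ cong (λ m → + m ℤ.* + d) i+j≡d ⟩
      + d ℤ.* + d                           ≡⟨ ℤ.*-identityˡ _ ⟨
      + 1 ℤ.* (+ d ℤ.* + d)                 ∎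
    p+q≡1 : p + q ≡ 1ℚ
    p+q≡1 = ℚ.toℚᵘ-injective (ℚᵘ.≃-trans (ℚ.toℚᵘ-homo-+ p q) (ℚᵘ.≃-trans
      (ℚᵘ.+-cong (ℚ.toℚᵘ-fromℚᵘ (ℚᵘ.mkℚᵘ (+ i) k)) (ℚ.toℚᵘ-fromℚᵘ (ℚᵘ.mkℚᵘ (+ j) k)))
      (ℚᵘ.*≡* num)))

module _ (n : ℕ) .{{_ : NonTrivial n}} where
  private
    instance
      n-1≢0 : NonZero (pred n)
      n-1≢0 = pred-nonZero n

  InGV : ℚ → Set
  InGV q = ∃ λ (i : Fin n) → q ≡ + toℕ i / pred n

  private
    ∼-closed : ∀ {x} → InGV x → InGV (1ℚ - x)
    ∼-closed (i , refl) = opposite i ,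
      /-complement (toℕ i) (toℕ (opposite i)) (pred n) (lemma i)
      where
      lemma : ∀ {m} (i : Fin m) → toℕ i ℕ.+ toℕ (opposite i) ≡ pred m
      lemma {suc m} i = trans (cong (toℕ i ℕ.+_) (opposite-prop i))
                              (ℕ.m+[n∸m]≡n (toℕ≤pred[n] i))

    0-closed : InGV 0ℚ
    0-closed = zeroth n , sym (trans (ℚ./-cong {q₂ = pred n} (cong +_ (toℕ-zeroth n)) refl)
                                     (0/ (pred n)))
      where
      zeroth : ∀ m .{{_ : NonTrivial m}} → Fin m
      zeroth (2+ _) = Fin.zero
      toℕ-zeroth : ∀ m .{{_ : NonTrivial m}} → toℕ (zeroth m) ≡ 0
      toℕ-zeroth (2+ _) = refl
      0/ : ∀ d .{{_ : NonZero d}} → + 0 / d ≡ 0ℚ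
      0/ (suc k) = ℚ.fromℚᵘ-cong {ℚᵘ.mkℚᵘ (+ 0) k} {ℚᵘ.0ℚᵘ} (ℚᵘ.*≡* refl)

    1-closed : InGV 1ℚ
    1-closed = ∼-closed 0-closed

    ∧-closed : ∀ {x y} → InGV x → InGV y → InGV (x ⊓ y)
    ∧-closed {x} {y} p q with ℚ.⊓-sel x y
    ... | inj₁ eq = subst InGV (sym eq) p
    ... | inj₂ eq = subst InGV (sym eq) q

    ⇒-closed : ∀ {x y} → InGV y → InGV (x ⇒ᴳ y)
    ⇒-closed {x} {y} q with x ≤? y
    ... | yes _ = 1-closed
    ... | no  _ = q

  GV : Algebra 0ℓ 0ℓ
  GV = record
    { Carrier       = ∃ InGV
    ; _≈_           = _≡_ on proj₁
    ; _∧_           = λ (x , p) (y , q) → x ⊓ y , ∧-closed p q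
    ; _⇒_           = λ (x , p) (y , q) → x ⇒ᴳ y , ⇒-closed {x} q
    ; ∼_            = λ (x , p) → 1ℚ - x , ∼-closed p
    ; ⊥             = 0ℚ , 0-closed
    ; isEquivalence = On.isEquivalence proj₁ ≡.isEquivalence
    ; ∧-cong        = cong₂ _⊓_
    ; ⇒-cong        = cong₂ _⇒ᴳ_
    ; ∼-cong        = cong (λ x → 1ℚ - x)
    }

  IsG∼Algebra : Algebra c ℓ → Set (lsuc 0ℓ ⊔ c ⊔ ℓ)
  IsG∼Algebra A = A ∈Variety GV

  IsG∼Chain : Algebra c ℓ → Set (lsuc 0ℓ ⊔ c ⊔ ℓ)
  IsG∼Chain A = IsG∼Algebra A × IsTotalOrder _≈_ _≤_
    where open Algebra A using (_≈_; _≤_)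

{-# OPTIONS --safe #-}

-- Write Δ d = ¬ ∼ d and d ▷ x = Δ d ⇒ x.  In GV the element d ▷ x is x if
-- d = 1 and is 1 otherwise, so in every algebra of the variety
-- "w ▷ x ≈ w ▷ y" is a congruence in x and y, and A is the product of its
-- quotients by d and by d ▷ ⊥.  Splitting successively along all the finitely
-- many elements d of A yields quotients in which each Δ d is ⊥ or ⊤; these are
-- chains since Δ (x ⇒ y) = ⊤ forces x ≤ y and Δ (x ⇒ y) = ⊥ forces y ≤ x.
-- Trivial factors are chains too, so they are not discarded.
module Submission where

open import Data.Fin.Base using (Fin)
open import Data.Nat.Base using (ℕ; _>_; s≤s; z≤n; n>1⇒nonTrivial)
open import Data.Nat.Properties using (≤-trans)
open import Data.Product.Base using (∃; _×_)
open import Defs hiding (var; _∧_; _⇒_; ∼_; ⊥)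
open import Data.Fin.Base using (zero; suc; toℕ; splitAt; _↑ˡ_; _↑ʳ_)
open import Data.Fin.Properties using (splitAt⁻¹-↑ˡ; splitAt⁻¹-↑ʳ) renaming (_≟_ to _≟ᶠ_)
open import Data.Integer.Base using (+_)
open import Data.List.Base using (_∷_; deduplicate; length; lookup)
open import Data.List.Membership.Propositional.Properties using (∈-allFin)
import Data.List.Membership.Setoid.Properties as Membership
import Data.List.Relation.Unary.All as All
open import Data.List.Relation.Unary.AllPairs using (_∷_)
open import Data.List.Relation.Unary.Enumerates.Setoid using (IsEnumeration)
open import Data.List.Relation.Unary.Enumerates.Setoid.Properties
  using (map⁺; deduplicate⁺; lookup-surjective)
open import Data.List.Relation.Unary.Unique.DecSetoid.Properties using (deduplicate-!)
open import Data.List.Relation.Unary.Unique.Setoid using (Unique)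
open import Data.Nat.Base using (NonZero; NonTrivial; pred; 2+; _+_)
open import Data.Product.Base using (_,_; proj₁; proj₂)
open import Data.Rational.Base using (ℚ; 0ℚ; 1ℚ; _⊓_; _-_; _/_)
import Data.Rational.Base as ℚ
import Data.Rational.Properties as ℚ
open import Data.Sum.Base using (_⊎_; inj₁; inj₂; [_,_]′)
import Data.Sum.Base as Sum
open import Data.Vec.Functional using (Vector; _++_)
import Data.Vec.Functional as Vector
open import Data.Vec.Functional.Relation.Unary.All.Properties using (++⁻ˡ; ++⁻ʳ)
open import Function.Base using (_∘_)
open import Function.Bundles using (Inverse; Surjection)
import Function.Construct.Symmetry as Symmetry
open import Function.Properties.Bijection using (Bijection⇒Inverse)
open import Function.Properties.Inverse using (Inverse⇒Injection)
open import Level using (Level; 0ℓ; _⊔_)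
open import Relation.Binary.Bundles using (Setoid; DecSetoid)
import Relation.Binary.Construct.NaturalOrder.Left as NaturalOrder
open import Relation.Binary.Core using (Rel)
open import Relation.Binary.PropositionalEquality as ≡
  using (_≡_; refl; cong; cong₂; subst)
open import Relation.Binary.Structures using (IsEquivalence; IsTotalOrder)
import Relation.Binary.Reasoning.Setoid as ≈-Reasoning
open import Relation.Nullary.Decidable using (yes; no; toSum; via-injection)
open import Relation.Nullary.Negation using (¬_; contradiction)

private
  variable
    a c ℓ : Level

-- Identities to be checked in `GV` and carried over to the variety.

module _ where
  open Term

  infixr 6 _▷ᵗ_

  _▷ᵗ_ : Term → Term → Term
  s ▷ᵗ t = ((∼ s) ⇒ ⊥) ⇒ t

  data Law : Rel Term 0ℓ where
    ∧-comm   : Law (var 0 ∧ var 1) (var 1 ∧ var 0)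
    ∧-assoc  : Law ((var 0 ∧ var 1) ∧ var 2) (var 0 ∧ (var 1 ∧ var 2))
    ∧-idem   : Law (var 0 ∧ var 0) (var 0)
    ⊤-▷      : Law ((∼ ⊥) ▷ᵗ var 0) (var 0)
    ▷-⊤      : Law (var 0 ▷ᵗ var 0) (var 0 ▷ᵗ (∼ ⊥))
    ▷-∧      : Law (var 0 ▷ᵗ (var 1 ∧ var 2)) ((var 0 ▷ᵗ var 1) ∧ (var 0 ▷ᵗ var 2))
    ▷-⇒      : Law (var 0 ▷ᵗ (var 1 ⇒ var 2)) ((var 0 ▷ᵗ var 1) ⇒ (var 0 ▷ᵗ var 2))
    -- Negation does not commute with `▷`: if `d` is not 1, then `d ▷ x` is 1 and its negation is 0.
    -- The outer `▷` hides this defect and still lets `∼` respect the quotients.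
    ▷-∼      : Law (var 0 ▷ᵗ (∼ var 1)) (var 0 ▷ᵗ (∼ (var 0 ▷ᵗ var 1)))
    ∧-▷      : Law ((var 0 ∧ var 1) ▷ᵗ var 2) (var 0 ▷ᵗ (var 1 ▷ᵗ var 2))
    choose   : Law ((var 0 ▷ᵗ var 1) ∧ ((var 0 ▷ᵗ ⊥) ▷ᵗ var 1)) (var 1)
    chooseˡ  : Law (var 0 ▷ᵗ ((var 0 ▷ᵗ var 1) ∧ ((var 0 ▷ᵗ ⊥) ▷ᵗ var 2))) (var 0 ▷ᵗ var 1)
    chooseʳ  : Law ((var 0 ▷ᵗ ⊥) ▷ᵗ ((var 0 ▷ᵗ var 1) ∧ ((var 0 ▷ᵗ ⊥) ▷ᵗ var 2)))
                   ((var 0 ▷ᵗ ⊥) ▷ᵗ var 2)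
    linearˡ  : Law ((var 0 ⇒ var 1) ▷ᵗ (var 0 ∧ var 1)) ((var 0 ⇒ var 1) ▷ᵗ var 0)
    linearʳ  : Law (((var 0 ⇒ var 1) ▷ᵗ ⊥) ▷ᵗ (var 0 ∧ var 1))
                   (((var 0 ⇒ var 1) ▷ᵗ ⊥) ▷ᵗ var 1)

-- Gödel implication and complement on the rationals.

⇒ᴳ-≤ : ∀ p q → p ℚ.≤ q → p ⇒ᴳ q ≡ 1ℚ
⇒ᴳ-≤ p q p≤q with p ℚ.≤? q
... | yes _   = refl
... | no  p≰q = contradiction p≤q p≰q

⇒ᴳ-≰ : ∀ p q → p ℚ.≰ q → p ⇒ᴳ q ≡ q
⇒ᴳ-≰ p q p≰q with p ℚ.≤? q
... | yes p≤q = contradiction p≤q p≰q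
... | no  _   = refl

1⇒ᴳ : ∀ q → q ℚ.≤ 1ℚ → 1ℚ ⇒ᴳ q ≡ q
1⇒ᴳ q q≤1 with 1ℚ ℚ.≤? q
... | yes 1≤q = ℚ.≤-antisym 1≤q q≤1
... | no  _   = refl

1-p≤0⇒1≤p : ∀ {p} → 1ℚ - p ℚ.≤ 0ℚ → 1ℚ ℚ.≤ p
1-p≤0⇒1≤p {p} 1-p≤0 = begin
  1ℚ                    ≡⟨ ℚ.+-identityʳ 1ℚ ⟨
  1ℚ ℚ.+ 0ℚ             ≡⟨ cong (1ℚ ℚ.+_) (ℚ.+-inverseˡ p) ⟨
  1ℚ ℚ.+ (ℚ.- p ℚ.+ p)  ≡⟨ ℚ.+-assoc 1ℚ (ℚ.- p) p ⟨
  (1ℚ - p) ℚ.+ p        ≤⟨ ℚ.+-monoˡ-≤ p 1-p≤0 ⟩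
  0ℚ ℚ.+ p              ≡⟨ ℚ.+-identityˡ p ⟩
  p                     ∎
  where open ℚ.≤-Reasoning

0≤1-p⇒p≤1 : ∀ {p} → 0ℚ ℚ.≤ 1ℚ - p → p ℚ.≤ 1ℚ
0≤1-p⇒p≤1 {p} 0≤1-p = begin
  p                     ≡⟨ ℚ.+-identityˡ p ⟨
  0ℚ ℚ.+ p              ≤⟨ ℚ.+-monoˡ-≤ p 0≤1-p ⟩
  (1ℚ - p) ℚ.+ p        ≡⟨ ℚ.+-assoc 1ℚ (ℚ.- p) p ⟩
  1ℚ ℚ.+ (ℚ.- p ℚ.+ p)  ≡⟨ cong (1ℚ ℚ.+_) (ℚ.+-inverseˡ p) ⟩
  1ℚ ℚ.+ 0ℚ             ≡⟨ ℚ.+-identityʳ 1ℚ ⟩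
  1ℚ                    ∎
  where open ℚ.≤-Reasoning

-- Guards and definition by cases.

module Conditional (A : Algebra c ℓ) where
  open Algebra A
  private module E = IsEquivalence isEquivalence

  infixr 6 _▷_

  ⊤ : Carrier
  ⊤ = ∼ ⊥

  _▷_ : Carrier → Carrier → Carrier
  x ▷ y = (∼ x ⇒ ⊥) ⇒ y

  -- `d ▷ ⊥` is the complement of Δ d, so in `GV` one conjunct is 1 and the other is the selected
  -- branch.
  if_then_else : Carrier → Carrier → Carrier → Carrier
  if d then x else y = (d ▷ x) ∧ ((d ▷ ⊥) ▷ y)

  ▷-cong : ∀ {x y u v} → x ≈ y → u ≈ v → x ▷ u ≈ y ▷ v
  ▷-cong x≈y = ⇒-cong (⇒-cong (∼-cong x≈y) E.refl)

-- Validity of the identities by case distinction on guards.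

record IsGödelChain (A : Algebra c ℓ) : Set (c ⊔ ℓ) where
  open Algebra A
  open Conditional A
  open IsEquivalence isEquivalence renaming (refl to ≈-refl; sym to ≈-sym; trans to ≈-trans)
  field
    comm  : ∀ x y → x ∧ y ≈ y ∧ x
    assoc : ∀ x y z → (x ∧ y) ∧ z ≈ x ∧ (y ∧ z)
    idem  : ∀ x → x ∧ x ≈ x
    ∧-⊤   : ∀ x → x ∧ ⊤ ≈ x
    ⊤-⇒   : ∀ x → ⊤ ⇒ x ≈ x
    ⊥-⇒   : ∀ x → ⊥ ⇒ x ≈ ⊤
    ∼⊤    : ∼ ⊤ ≈ ⊥
    ⊤≉⊥   : ¬ ⊤ ≈ ⊥
    Δ-sel : ∀ d → d ≈ ⊤ ⊎ ¬ d ≈ ⊤ × ∼ d ⇒ ⊥ ≈ ⊥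
    ⇒-sel : ∀ x y → (x ⇒ y ≈ ⊤ × x ∧ y ≈ x) ⊎ (x ⇒ y ≈ y × x ∧ y ≈ y)

  ⊤-∧ : ∀ x → ⊤ ∧ x ≈ x
  ⊤-∧ x = ≈-trans (comm ⊤ x) (∧-⊤ x)

  On Off : Carrier → Set (c ⊔ ℓ)
  On  d = d ≈ ⊤ × (∀ x → d ▷ x ≈ x)
  Off d = ¬ d ≈ ⊤ × (∀ x → d ▷ x ≈ ⊤)

  on⊎off : ∀ d → On d ⊎ Off d
  on⊎off d with Δ-sel d
  ... | inj₁ d≈⊤        = inj₁ (d≈⊤ , λ x → ≈-trans
    (⇒-cong (≈-trans (⇒-cong (≈-trans (∼-cong d≈⊤) ∼⊤) ≈-refl) (⊥-⇒ ⊥)) ≈-refl) (⊤-⇒ x))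
  ... | inj₂ (d≉⊤ , Δd) = inj₂ (d≉⊤ , λ x → ≈-trans (⇒-cong Δd ≈-refl) (⊥-⇒ x))

  -- If both guards were on, `d ▷ ⊥` would be `⊤` and `⊥` at once; if `d` is off, `d ▷ ⊥` is `⊤` and
  -- hence on.
  on-off⊎off-on : ∀ d → (On d × Off (d ▷ ⊥)) ⊎ (Off d × On (d ▷ ⊥))
  on-off⊎off-on d with on⊎off d | on⊎off (d ▷ ⊥)
  ... | inj₁ on       | inj₂ off      = inj₁ (on , off)
  ... | inj₂ off      | inj₁ on       = inj₂ (off , on)
  ... | inj₁ (_ , d▷) | inj₁ (≈⊤ , _) = contradiction (≈-trans (≈-sym ≈⊤) (d▷ ⊥)) ⊤≉⊥
  ... | inj₂ (_ , d▷) | inj₂ (≉⊤ , _) = contradiction (d▷ ⊥) ≉⊤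

  A⊨Law : A ⊨ Law
  A⊨Law ∧-comm ρ = comm _ _
  A⊨Law ∧-assoc ρ = assoc _ _ _
  A⊨Law ∧-idem ρ = idem _
  A⊨Law ⊤-▷ ρ with on⊎off ⊤
  ... | inj₁ (_ , ⊤▷)  = ⊤▷ _
  ... | inj₂ (⊤≉⊤ , _) = contradiction ≈-refl ⊤≉⊤
  A⊨Law ▷-⊤ ρ with on⊎off (ρ 0)
  ... | inj₁ (d≈⊤ , d▷) = ≈-trans (d▷ _) (≈-trans d≈⊤ (≈-sym (d▷ _)))
  ... | inj₂ (_   , d▷) = ≈-trans (d▷ _) (≈-sym (d▷ _))
  A⊨Law ▷-∧ ρ with on⊎off (ρ 0)
  ... | inj₁ (_ , d▷) = ≈-trans (d▷ _) (≈-sym (∧-cong (d▷ _) (d▷ _)))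
  ... | inj₂ (_ , d▷) = ≈-trans (d▷ _) (≈-sym (≈-trans (∧-cong (d▷ _) (d▷ _)) (idem ⊤)))
  A⊨Law ▷-⇒ ρ with on⊎off (ρ 0)
  ... | inj₁ (_ , d▷) = ≈-trans (d▷ _) (≈-sym (⇒-cong (d▷ _) (d▷ _)))
  ... | inj₂ (_ , d▷) = ≈-trans (d▷ _) (≈-sym (≈-trans (⇒-cong (d▷ _) (d▷ _)) (⊤-⇒ ⊤)))
  A⊨Law ▷-∼ ρ with on⊎off (ρ 0)
  ... | inj₁ (_ , d▷) = ≈-trans (d▷ _) (≈-sym (≈-trans (d▷ _) (∼-cong (d▷ _))))
  ... | inj₂ (_ , d▷) = ≈-trans (d▷ _) (≈-sym (d▷ _))
  A⊨Law ∧-▷ ρ with on⊎off (ρ 0) | on⊎off (ρ 0 ∧ ρ 1)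
  ... | inj₁ (d≈⊤ , d▷) | _ = ≈-trans
    (▷-cong (≈-trans (∧-cong d≈⊤ ≈-refl) (⊤-∧ _)) ≈-refl) (≈-sym (d▷ _))
  -- A meet equal to `⊤` has first factor `⊤`, so this combination is impossible.
  ... | inj₂ (d≉⊤ , _) | inj₁ (≈⊤ , _) = contradiction
    (begin
      ρ 0                ≈⟨ ∧-⊤ _ ⟨
      ρ 0 ∧ ⊤            ≈⟨ ∧-cong ≈-refl ≈⊤ ⟨
      ρ 0 ∧ (ρ 0 ∧ ρ 1)  ≈⟨ assoc _ _ _ ⟨
      (ρ 0 ∧ ρ 0) ∧ ρ 1  ≈⟨ ∧-cong (idem _) ≈-refl ⟩
      ρ 0 ∧ ρ 1          ≈⟨ ≈⊤ ⟩
      ⊤                  ∎) d≉⊤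
    where open ≈-Reasoning setoid
  ... | inj₂ (_ , d▷) | inj₂ (_ , d∧w▷) = ≈-trans (d∧w▷ _) (≈-sym (d▷ _))
  A⊨Law choose ρ with on-off⊎off-on (ρ 0)
  ... | inj₁ ((_ , d▷) , (_ , ¬d▷)) = ≈-trans (∧-cong (d▷ _) (¬d▷ _)) (∧-⊤ _)
  ... | inj₂ ((_ , d▷) , (_ , ¬d▷)) = ≈-trans (∧-cong (d▷ _) (¬d▷ _)) (⊤-∧ _)
  A⊨Law chooseˡ ρ with on-off⊎off-on (ρ 0)
  ... | inj₁ ((_ , d▷) , (_ , ¬d▷)) = ≈-trans (d▷ _) (≈-trans (∧-cong ≈-refl (¬d▷ _)) (∧-⊤ _))
  ... | inj₂ ((_ , d▷) , _)         = ≈-trans (d▷ _) (≈-sym (d▷ _))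
  A⊨Law chooseʳ ρ with on-off⊎off-on (ρ 0)
  ... | inj₁ (_ , (_ , ¬d▷))        = ≈-trans (¬d▷ _) (≈-sym (¬d▷ _))
  ... | inj₂ ((_ , d▷) , (_ , ¬d▷)) = ≈-trans (¬d▷ _) (≈-trans (∧-cong (d▷ _) ≈-refl) (⊤-∧ _))
  A⊨Law linearˡ ρ with ⇒-sel (ρ 0) (ρ 1) | on⊎off (ρ 0 ⇒ ρ 1)
  ... | inj₁ (_ , x∧y≈x)   | _ = ▷-cong ≈-refl x∧y≈x
  ... | inj₂ _             | inj₂ (_ , ▷≈⊤) = ≈-trans (▷≈⊤ _) (≈-sym (▷≈⊤ _))
  -- Here `y` is itself `⊤`, so the meet with `y` changes nothing.
  ... | inj₂ (x⇒y≈y , x∧y≈y) | inj₁ (x⇒y≈⊤ , _) = ▷-cong ≈-refl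
    (≈-trans (∧-cong ≈-refl (≈-trans (≈-sym x⇒y≈y) x⇒y≈⊤)) (∧-⊤ _))
  A⊨Law linearʳ ρ with ⇒-sel (ρ 0) (ρ 1) | on-off⊎off-on (ρ 0 ⇒ ρ 1)
  ... | inj₂ (_ , x∧y≈y) | _ = ▷-cong ≈-refl x∧y≈y
  ... | inj₁ (x⇒y≈⊤ , _) | inj₁ (_ , (_ , ▷≈⊤)) = ≈-trans (▷≈⊤ _) (≈-sym (▷≈⊤ _))
  ... | inj₁ (x⇒y≈⊤ , _) | inj₂ ((≉⊤ , _) , _)  = contradiction x⇒y≈⊤ ≉⊤

-- The rational chain `GV`.

module _ (n : ℕ) .{{_ : NonTrivial n}} where
  open Algebra (GV n)
  open Conditional (GV n) using (⊤)

  GV-≥0 : ∀ (x : Carrier) → 0ℚ ℚ.≤ proj₁ x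
  GV-≥0 (_ , i , refl) = 0≤/ (toℕ i) (pred n) {{pred-nonZero n}}
    where
    pred-nonZero : ∀ m → .{{NonTrivial m}} → NonZero (pred m)
    pred-nonZero (2+ _) = _
    0≤/ : ∀ j d .{{_ : NonZero d}} → 0ℚ ℚ.≤ + j / d
    0≤/ j d = ℚ.nonNegative⁻¹ (+ j / d) {{ℚ.normalize-nonNeg j d}}

  -- Closure under `∼` makes 1 - x a nonnegative element too.
  GV-≤1 : ∀ (x : Carrier) → proj₁ x ℚ.≤ 1ℚ
  GV-≤1 x = 0≤1-p⇒p≤1 (GV-≥0 (∼ x))

  -- For `d` below 1 the premise 1 - d is positive, so the implication returns its conclusion 0.
  GV-Δ-sel : ∀ d → d ≈ ⊤ ⊎ ¬ d ≈ ⊤ × ∼ d ⇒ ⊥ ≈ ⊥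
  GV-Δ-sel d = [ inj₁ , (λ d≢1 → inj₂ (d≢1 ,
    ⇒ᴳ-≰ (1ℚ - proj₁ d) 0ℚ (d≢1 ∘ ℚ.≤-antisym (GV-≤1 d) ∘ 1-p≤0⇒1≤p))) ]′ (toSum (proj₁ d ℚ.≟ 1ℚ))

  GV-⇒-sel : ∀ x y → (x ⇒ y ≈ ⊤ × x ∧ y ≈ x) ⊎ (x ⇒ y ≈ y × x ∧ y ≈ y)
  GV-⇒-sel x y = [ (λ x≤y → inj₁ (⇒ᴳ-≤ (proj₁ x) (proj₁ y) x≤y , ℚ.p≤q⇒p⊓q≡p x≤y))
                 , (λ x≰y → inj₂ (⇒ᴳ-≰ (proj₁ x) (proj₁ y) x≰y , ℚ.p≥q⇒p⊓q≡q (ℚ.<⇒≤ (ℚ.≰⇒> x≰y))))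
                 ]′ (toSum (proj₁ x ℚ.≤? proj₁ y))

  GV-isGödelChain : IsGödelChain (GV n)
  GV-isGödelChain = record
    { comm  = λ x y → ℚ.⊓-comm (proj₁ x) (proj₁ y)
    ; assoc = λ x y z → ℚ.⊓-assoc (proj₁ x) (proj₁ y) (proj₁ z)
    ; idem  = λ x → ℚ.⊓-idem (proj₁ x)
    ; ∧-⊤   = λ x → ℚ.p≤q⇒p⊓q≡p (GV-≤1 x)
    ; ⊤-⇒   = λ x → 1⇒ᴳ (proj₁ x) (GV-≤1 x)
    ; ⊥-⇒   = λ x → ⇒ᴳ-≤ 0ℚ (proj₁ x) (GV-≥0 x)
    ; ∼⊤    = refl
    ; ⊤≉⊥   = λ ()
    ; Δ-sel = GV-Δ-sel
    ; ⇒-sel = GV-⇒-sel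
    }

-- Finiteness from enumerations, and concatenated vectors.

module _ (S : Setoid a ℓ) where
  open Setoid S using (_≈_) renaming (sym to ≈-sym; trans to ≈-trans)

  lookup-injective : ∀ {xs} → Unique S xs → ∀ i j → lookup xs i ≈ lookup xs j → i ≡ j
  lookup-injective {_ ∷ xs} (x∉xs ∷ xs!) = λ
    { zero    zero    _  → refl
    ; zero    (suc j) eq → contradiction eq (x≉ j)
    ; (suc i) zero    eq → contradiction (≈-sym eq) (x≉ i)
    ; (suc i) (suc j) eq → cong suc (lookup-injective xs! i j eq)
    }
    where
    x≉ : ∀ j → ¬ _ ≈ lookup xs j
    x≉ j = All.lookupₛ S (λ y≈z x≉y x≈z → x≉y (≈-trans x≈z (≈-sym y≈z)))
                       x∉xs (Membership.∈-lookup S xs j)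

module _ (S? : DecSetoid a ℓ) where
  open DecSetoid S? using (_≟_) renaming (setoid to S)

  -- Deleting duplicates makes indexing into the list injective and keeps it surjective.
  enumeration⇒finite : ∀ {xs} → IsEnumeration S xs → ∃ λ m → Inverse S (≡.setoid (Fin m))
  enumeration⇒finite {xs} xs-enum = length ys , Symmetry.inverse (Bijection⇒Inverse record
    { to        = lookup ys
    ; cong      = λ { refl → Setoid.refl S }
    ; bijective = lookup-injective S (deduplicate-! S? xs) _ _
                , lookup-surjective S (deduplicate⁺ S? xs-enum)
    })
    where ys = deduplicate _≟_ xs

-- The predicate sees the index too, since gluing compares the cell at `i` with the prescribed value
-- `f i`.
++-elim : ∀ {b p} {B : Set b} {m n} (P : Fin (m + n) → B → Set p)
          (xs : Vector B m) (ys : Vector B n) →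
          (∀ i → P (i ↑ˡ n) (xs i)) → (∀ i → P (m ↑ʳ i) (ys i)) →
          ∀ i → P i ((xs ++ ys) i)
++-elim {m = m} P xs ys pxs pys i with splitAt m i in eq
... | inj₁ j = subst (λ i → P i (xs j)) (splitAt⁻¹-↑ˡ eq) (pxs j)
... | inj₂ j = subst (λ i → P i (ys j)) (splitAt⁻¹-↑ʳ eq) (pys j)

-- Quotients of a model of the identities.

module Decomposition (A : Algebra c ℓ) (A⊨Law : A ⊨ Law) where
  open Algebra A
  open Conditional A
  open IsEquivalence isEquivalence
    renaming (refl to ≈-refl; sym to ≈-sym; trans to ≈-trans)
  open ≈-Reasoning setoid

  private
    -- Three values suffice, as only variables 0, 1 and 2 occur; where fewer occur, the spare
    -- arguments are arbitrary.
    law : ∀ {s t} → Law s t → ∀ x y z →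
          let ρ = λ { 0 → x ; 1 → y ; _ → z } in ⟦ A ⟧ s ρ ≈ ⟦ A ⟧ t ρ
    law l x y z = A⊨Law l _

  -- Only the equality is coarsened, to the kernel of `w ▷_`. Terms therefore evaluate as in `A`,
  -- and the projection is the identity function.
  quotient : Carrier → Algebra c ℓ
  quotient w = record
    { Carrier       = Carrier
    ; _≈_           = λ x y → w ▷ x ≈ w ▷ y
    ; _∧_           = _∧_
    ; _⇒_           = _⇒_
    ; ∼_            = ∼_
    ; ⊥             = ⊥
    ; isEquivalence = record { refl = ≈-refl ; sym = ≈-sym ; trans = ≈-trans }
    ; ∧-cong        = λ {x} {y} {u} {v} p q → begin
        w ▷ (x ∧ u)        ≈⟨ law ▷-∧ w x u ⟩
        (w ▷ x) ∧ (w ▷ u)  ≈⟨ ∧-cong p q ⟩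
        (w ▷ y) ∧ (w ▷ v)  ≈⟨ law ▷-∧ w y v ⟨
        w ▷ (y ∧ v)        ∎
    ; ⇒-cong        = λ {x} {y} {u} {v} p q → begin
        w ▷ (x ⇒ u)        ≈⟨ law ▷-⇒ w x u ⟩
        (w ▷ x) ⇒ (w ▷ u)  ≈⟨ ⇒-cong p q ⟩
        (w ▷ y) ⇒ (w ▷ v)  ≈⟨ law ▷-⇒ w y v ⟨
        w ▷ (y ⇒ v)        ∎
    ; ∼-cong        = λ {x} {y} p → begin
        w ▷ ∼ x            ≈⟨ law ▷-∼ w x x ⟩
        w ▷ ∼ (w ▷ x)      ≈⟨ ▷-cong ≈-refl (∼-cong p) ⟩
        w ▷ ∼ (w ▷ y)      ≈⟨ law ▷-∼ w y y ⟨
        w ▷ ∼ y            ∎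
    }

  infix 4 _≈[_]_

  _≈[_]_ : Carrier → Carrier → Carrier → Set ℓ
  x ≈[ w ] y = Algebra._≈_ (quotient w) x y

  ≈⇒≈[_] : ∀ w {x y} → x ≈ y → x ≈[ w ] y
  ≈⇒≈[ w ] = ▷-cong ≈-refl

  ⟦⟧-quotient : ∀ w t ρ → ⟦ quotient w ⟧ t ρ ≡ ⟦ A ⟧ t ρ
  ⟦⟧-quotient w (Term.var i) ρ = refl
  ⟦⟧-quotient w (s Term.∧ t) ρ = cong₂ _∧_ (⟦⟧-quotient w s ρ) (⟦⟧-quotient w t ρ)
  ⟦⟧-quotient w (s Term.⇒ t) ρ = cong₂ _⇒_ (⟦⟧-quotient w s ρ) (⟦⟧-quotient w t ρ)
  ⟦⟧-quotient w (Term.∼ t)   ρ = cong ∼_ (⟦⟧-quotient w t ρ)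
  ⟦⟧-quotient w Term.⊥       ρ = refl

  quotient-⊨ : ∀ w {E} → A ⊨ E → quotient w ⊨ E
  quotient-⊨ w A⊨E {s} {t} e ρ rewrite ⟦⟧-quotient w s ρ | ⟦⟧-quotient w t ρ = ≈⇒≈[ w ] (A⊨E e ρ)

  -- Equality modulo `w` is an equality in `A`, which is decided through the bijection with `Fin m`;
  -- the enumeration of `A` then also enumerates the quotient.
  quotient-finite : Finite A → ∀ w → Finite (quotient w)
  quotient-finite (m , A↔Fin) w = enumeration⇒finite S?
    (map⁺ (≡.setoid (Fin m)) (DecSetoid.setoid S?) Fin↠S ∈-allFin)
    where
    open Inverse A↔Fin
    S? : DecSetoid _ _
    S? = record
      { isDecEquivalence = record
        { isEquivalence = Algebra.isEquivalence (quotient w)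
        ; _≟_           = λ x y → via-injection (Inverse⇒Injection A↔Fin) _≟ᶠ_ (w ▷ x) (w ▷ y)
        }
      }
    Fin↠S : Surjection (≡.setoid (Fin m)) (DecSetoid.setoid S?)
    Fin↠S = record
      { to         = from
      ; cong       = λ { refl → ≈-refl }
      ; surjective = λ x → to x , λ { refl → ≈⇒≈[ w ] (strictlyInverseʳ x) }
      }

  -- A guard that is a meet unfolds into nested guards; commuting the meet puts `d` innermost.
  ≈[∧]ˡ : ∀ d w {x y} → d ▷ x ≈[ w ] d ▷ y → x ≈[ d ∧ w ] y
  ≈[∧]ˡ d w {x} {y} p = begin
    (d ∧ w) ▷ x  ≈⟨ ▷-cong (law ∧-comm d w w) ≈-refl ⟩
    (w ∧ d) ▷ x  ≈⟨ law ∧-▷ w d x ⟩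
    w ▷ (d ▷ x)  ≈⟨ p ⟩
    w ▷ (d ▷ y)  ≈⟨ law ∧-▷ w d y ⟨
    (w ∧ d) ▷ y  ≈⟨ ▷-cong (law ∧-comm d w w) ≈-refl ⟨
    (d ∧ w) ▷ y  ∎

  ≈[∧]ˡ⁻¹ : ∀ d w {x y} → x ≈[ d ∧ w ] y → d ▷ x ≈[ w ] d ▷ y
  ≈[∧]ˡ⁻¹ d w {x} {y} p = begin
    w ▷ (d ▷ x)  ≈⟨ law ∧-▷ w d x ⟨
    (w ∧ d) ▷ x  ≈⟨ ▷-cong (law ∧-comm d w w) ≈-refl ⟨
    (d ∧ w) ▷ x  ≈⟨ p ⟩
    (d ∧ w) ▷ y  ≈⟨ ▷-cong (law ∧-comm d w w) ≈-refl ⟩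
    (w ∧ d) ▷ y  ≈⟨ law ∧-▷ w d y ⟩
    w ▷ (d ▷ y)  ∎

  ≈[]⇒≈[∧]ˡ : ∀ d w {x y} → x ≈[ d ] y → x ≈[ d ∧ w ] y
  ≈[]⇒≈[∧]ˡ d w p = ≈[∧]ˡ d w (≈⇒≈[ w ] p)

  ≈[]⇒≈[∧]ʳ : ∀ d w {x y} → x ≈[ w ] y → x ≈[ d ∧ w ] y
  ≈[]⇒≈[∧]ʳ d w {x} {y} p = begin
    (d ∧ w) ▷ x  ≈⟨ law ∧-▷ d w x ⟩
    d ▷ (w ▷ x)  ≈⟨ ▷-cong ≈-refl p ⟩
    d ▷ (w ▷ y)  ≈⟨ law ∧-▷ d w y ⟨
    (d ∧ w) ▷ y  ∎

  -- `x` is recovered from its two guarded parts as `if d then x else x`.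
  ≈[]-separate : ∀ d {x y} → x ≈[ d ] y → x ≈[ d ▷ ⊥ ] y → x ≈ y
  ≈[]-separate d {x} {y} p q = begin
    x                   ≈⟨ law choose d x x ⟨
    if d then x else x  ≈⟨ ∧-cong p q ⟩
    if d then y else y  ≈⟨ law choose d y y ⟩
    y                   ∎

  -- The second case says that Δ d becomes `⊥`, but is phrased as an equation with `⊤` so that
  -- `by-⊤` serves both cases.
  Decided : Carrier → Carrier → Set ℓ
  Decided d w = d ≈[ w ] ⊤ ⊎ d ▷ ⊥ ≈[ w ] ⊤

  -- `separate` and `glue` are injectivity and surjectivity of the diagonal map into the product of
  -- the quotients by the cells.
  record Partition {m} (ds : Vector Carrier m) : Set (c ⊔ ℓ) where
    field
      size     : ℕ
      cell     : Vector Carrier size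
      separate : ∀ {x y} → (∀ i → x ≈[ cell i ] y) → x ≈ y
      glue     : ∀ (f : Vector Carrier size) → ∃ λ x → ∀ i → x ≈[ cell i ] f i
      decided  : ∀ i j → Decided (ds j) (cell i)

  -- Each further element `d` splits every cell `w` into `d ∧ w` and `(d ▷ ⊥) ∧ w`.
  partition : ∀ {m} (ds : Vector Carrier m) → Partition ds
  partition {ℕ.zero} ds = record
    -- With nothing to split, the single cell `⊤` gives `A` itself as quotient.
    { size     = 1
    ; cell     = λ _ → ⊤
    ; separate = λ {x} {y} p → begin
        x      ≈⟨ law ⊤-▷ x x x ⟨
        ⊤ ▷ x  ≈⟨ p zero ⟩
        ⊤ ▷ y  ≈⟨ law ⊤-▷ y y y ⟩
        y      ∎
    ; glue     = λ f → f zero , λ { zero → ≈-refl }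
    ; decided  = λ _ ()
    }
  partition {ℕ.suc m} ds = record
    { size     = size + size
    ; cell     = cellˡ ++ cellʳ
    -- The induction hypothesis is applied to the guarded elements: first to `d ▷ x` and `d ▷ y`,
    -- then to those guarded by `d ▷ ⊥`.
    ; separate = λ {x} {y} p → ≈[]-separate d
        (separate (λ i → ≈[∧]ˡ⁻¹ d (cell i) (++⁻ˡ (x ≈[_] y) cellˡ p i)))
        (separate (λ i → ≈[∧]ˡ⁻¹ (d ▷ ⊥) (cell i) (++⁻ʳ (x ≈[_] y) cellˡ p i)))
    -- `x` solves the left half and `y` the right half; `z` agrees with `x` modulo `d` and with `y`
    -- modulo `d ▷ ⊥`.
    ; glue     = λ f →
        let x , px = glue (λ i → f (i ↑ˡ size))
            y , py = glue (λ i → f (size ↑ʳ i))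
            z      = if d then x else y
        in z , ++-elim (λ i w → z ≈[ w ] f i) cellˡ cellʳ
          (λ i → ≈-trans (≈[]⇒≈[∧]ˡ d (cell i) (law chooseˡ d x y)) (≈[]⇒≈[∧]ʳ d (cell i) (px i)))
          (λ i → ≈-trans (≈[]⇒≈[∧]ˡ (d ▷ ⊥) (cell i) (law chooseʳ d x y))
                         (≈[]⇒≈[∧]ʳ (d ▷ ⊥) (cell i) (py i)))
    -- The new element is decided because each guard becomes `⊤` in its own quotient; earlier
    -- decisions survive in coarser quotients.
    ; decided  = ++-elim (λ _ w → ∀ j → Decided (ds j) w) cellˡ cellʳ
        (λ { i zero    → inj₁ (≈[]⇒≈[∧]ˡ d (cell i) (law ▷-⊤ d d d))
           ; i (suc j) → Sum.map (≈[]⇒≈[∧]ʳ d (cell i)) (≈[]⇒≈[∧]ʳ d (cell i)) (decided i j) })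
        (λ { i zero    → inj₂ (≈[]⇒≈[∧]ˡ (d ▷ ⊥) (cell i) (law ▷-⊤ (d ▷ ⊥) d d))
           ; i (suc j) → Sum.map (≈[]⇒≈[∧]ʳ (d ▷ ⊥) (cell i)) (≈[]⇒≈[∧]ʳ (d ▷ ⊥) (cell i))
                                 (decided i j) })
    }
    where
    open Partition (partition (λ j → ds (suc j)))
    d     = ds zero
    cellˡ = Vector.map (d ∧_) cell
    cellʳ = Vector.map ((d ▷ ⊥) ∧_) cell

  -- Deciding the guard `x ⇒ y` makes the meet of `x` and `y` equal to one of them: to `x` if the
  -- guard is `⊤`, to `y` if its complement is.
  quotient-total : ∀ w → (∀ d → Decided d w) →
                   IsTotalOrder (Algebra._≈_ (quotient w)) (Algebra._≤_ (quotient w))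
  quotient-total w decided = NaturalOrder.isTotalOrder (_≈[ w ]_) _∧_
    record
      { isBand = record
        { isSemigroup = record
          { isMagma = record { isEquivalence = Q.isEquivalence ; ∙-cong = Q.∧-cong }
          ; assoc   = λ x y z → ≈⇒≈[ w ] (law ∧-assoc x y z)
          }
        ; idem = λ x → ≈⇒≈[ w ] (law ∧-idem x x x)
        }
      ; comm = λ x y → ≈⇒≈[ w ] (law ∧-comm x y y)
      }
    (λ x y → Sum.map
      (λ p → by-⊤ p (law linearˡ x y y)) (λ p → by-⊤ p (law linearʳ x y y)) (decided (x ⇒ y)))
    where
    module Q = Algebra (quotient w)
    open Conditional (quotient w) using () renaming (▷-cong to ▷-congᵠ)
    -- Modulo `w` the guard `d` may be replaced by `⊤`, and guarding by `⊤` does nothing.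
    by-⊤ : ∀ {d x y} → d ≈[ w ] ⊤ → x ≈[ d ] y → x ≈[ w ] y
    by-⊤ {d} {x} {y} d≈⊤ p = begin
      w ▷ x        ≈⟨ ≈⇒≈[ w ] (law ⊤-▷ x x x) ⟨
      w ▷ (⊤ ▷ x)  ≈⟨ ▷-congᵠ {d} {⊤} {x} {x} d≈⊤ ≈-refl ⟨
      w ▷ (d ▷ x)  ≈⟨ ≈⇒≈[ w ] p ⟩
      w ▷ (d ▷ y)  ≈⟨ ▷-congᵠ {d} {⊤} {y} {y} d≈⊤ ≈-refl ⟩
      w ▷ (⊤ ▷ y)  ≈⟨ ≈⇒≈[ w ] (law ⊤-▷ y y y) ⟩
      w ▷ y        ∎

  -- Splitting a finite algebra along all its elements.

  module _ (A-finite : Finite A) where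
    open Inverse (proj₂ A-finite)
    open Partition (partition from) public

    cell-decided : ∀ i d → Decided d (cell i)
    cell-decided i d = Sum.map
      (≈-trans (≈⇒≈[ cell i ] (≈-sym from∘to)))
      (≈-trans (≈⇒≈[ cell i ] (▷-cong (≈-sym from∘to) ≈-refl)))
      (decided i (to d))
      where from∘to = strictlyInverseʳ d

    ≅-∏-quotient : A ≅ ∏ (λ i → quotient (cell i))
    ≅-∏-quotient = record
      { bijection = record
        -- All factors share the carrier of `A`, so the diagonal map is a constant family and
        -- preserves the operations on the nose.
        { to        = λ x _ → x
        ; cong      = λ x≈y i → ≈⇒≈[ cell i ] x≈y
        ; bijective = separate
                    , λ f → let x , p = glue f in x , λ z≈x i → ≈-trans (≈⇒≈[ cell i ] z≈x) (p i)
        }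
      ; isHomomorphism = record
        { ∧-homo = λ _ _ _ → ≈-refl
        ; ⇒-homo = λ _ _ _ → ≈-refl
        ; ∼-homo = λ _ _ → ≈-refl
        ; ⊥-homo = λ _ → ≈-refl
        }
      }

proposition3 : ∀ {c ℓ} (n : ℕ) (n>4 : n > 4) →
    let instance _ = n>1⇒nonTrivial (≤-trans (s≤s (s≤s z≤n)) n>4) in
    (A : Algebra c ℓ) → IsG∼Algebra n A → Finite A →
    ∃ λ k → ∃ λ (B : Fin k → Algebra c ℓ) →
      (∀ i → IsG∼Chain n (B i) × Finite (B i)) × A ≅ ∏ B
proposition3 n n>4 A A∈V A-finite =
    size A-finite , (λ i → quotient (cell A-finite i))
  , (λ i → let w = cell A-finite i in
        ( (λ E GV⊨E → quotient-⊨ w {E} (A∈V E GV⊨E))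
        , quotient-total w (cell-decided A-finite i))
      , quotient-finite A-finite w)
  , ≅-∏-quotient A-finite
  where
  instance
    n-nonTrivial : NonTrivial n
    n-nonTrivial = n>1⇒nonTrivial (≤-trans (s≤s (s≤s z≤n)) n>4)
  -- Membership in the variety is instantiated at the single set of identities `Law`, which holds in
  -- `GV`.
  open Decomposition A (A∈V Law (IsGödelChain.A⊨Law (GV-isGödelChain n)))
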